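{- Let $0<k\in\mathbb{Z}$ and $n=2k+1$. The graph $R_k$ is a quotient graph of the middle-levels graph $M_k$ under an action $\Upsilon:D_{2n}\times M_k\rightarrow M_k$ of the dihedral group $D_{2n}$ of order $2n$.
   Context: Let $n=2k+1$. $M_k$ is the graph whose vertices are the binary $n$-strings $b_0b_1\cdots b_{n-1}$ of weight $k$ (set $L_k$) or weight $k+1$ (set $L_{k+1}$) (equivalently the $k$- and $(k+1)$-subsets of $\{0,\ldots,2k\}$ via characteristic vectors), two of them being adjacent iff they differ in exactly one entry. For a set $A\subseteq\{0,\ldots,2k\}$, $B_A$ denotes its characteristic string. $\mathbb{Z}_n$ acts on $M_k$ by cyclic translation of coordinates mod $n$. $M_k/\pi$ is the quotient (multi)graph: its vertices are the classes $(b_0\cdots b_{n-1})$ of vertices of $M_k$ under translation and its edges are the classes of edges of $M_k$ under translation. The complemented reversal $\aleph$, $\aleph(b_0b_1\cdots b_{2k})=\bar b_{2k}\cdots\bar b_1\bar b_0$ (with $\bar0=1,\bar1=0$), is an involution of $M_k$ exchanging $L_k$ and $L_{k+1}$, and it induces an involution $\aleph_\pi$ of $M_k/\pi$. An edge of $M_k/\pi$ is horizontal if it joins some class $v$ to $\aleph_\pi(v)$; otherwise it is skew. $R_k$ is the graph (with loops allowed) whose vertices are the pairs $\langle B_A\rangle=\{(B_A),\aleph_\pi((B_A))\}$ with $|A|=k$, having: (1) an edge $\langle B_A\rangle\langle B_{A'}\rangle$ for each pair of skew edges $\{(B_A)\aleph_\pi((B_{A'})),(B_{A'})\aleph_\pi((B_A))\}$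 of $M_k/\pi$ exchanged by $\aleph_\pi$; (2) a loop at $\langle B_A\rangle$ for each horizontal edge $(B_A)\aleph_\pi((B_A))$ of $M_k/\pi$ (counted with multiplicity). The quotient graph of $M_k$ under a group action by automorphisms has as vertices the vertex orbits and as edges (or loops) the edge orbits. -}

module Defs where

open import Algebra.Bundles using (Group; AbelianGroup)
import Algebra.Properties.AbelianGroup as AbelianGroupProperties
open import Data.Bool.Base using (Bool; true; false; not; if_then_else_)
open import Data.Bool.Properties using (not-involutive; not-injective)
open import Data.Fin.Base using (Fin; toℕ; opposite)
open import Data.Fin.Permutation as Permutation using (Permutation′; permutation; _⟨$⟩ʳ_; _⟨$⟩ˡ_)
open import Data.Fin.Properties
  using (toℕ-injective; toℕ-fromℕ<; toℕ<n; toℕ≤pred[n]; opposite-prop; opposite-involutive)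
open import Data.Fin.Subset using (Subset; ∣_∣; ∁)
open import Data.Fin.Subset.Properties using (∣∁p∣≡n∸∣p∣)
open import Data.Nat.Base using (ℕ; suc; _+_; _*_; _∸_; _%_; NonZero; >-nonZero⁻¹)
open import Data.Nat.DivMod using (_mod_; %-distribˡ-+; m%n%n≡m%n; m<n⇒m%n≡m; n%n≡0; m%n<n)
import Data.Nat.Properties as ℕ
open import Data.Product.Base using (Σ-syntax; ∃; ∃₂; ∃-syntax; _×_; _,_; proj₁; proj₂)
open import Data.Product using (∃!)
open import Data.Sign.Base as Sign using (Sign)
import Data.Sign.Properties as Sign
open import Data.Sum.Base using (_⊎_; inj₁; inj₂; [_,_]′)
open import Data.Sum.Relation.Binary.Pointwise using (_⊎ₛ_; inj₁; inj₂)
open import Data.Vec.Base using (lookup; tabulate; []; _∷_)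
open import Data.Vec.Properties using (lookup∘tabulate; tabulate∘lookup; tabulate-cong; lookup-map)
open import Function.Base using (_∘_)
open import Function.Bundles using (Func; Inverse)
open import Level using (0ℓ)
open import Relation.Binary.Bundles using (Setoid)
import Relation.Binary.Construct.On as On
open import Relation.Binary.Core using (Rel)
open import Relation.Binary.PropositionalEquality
  using (_≡_; _≢_; refl; sym; trans; cong; cong₂; subst; isEquivalence; setoid; module ≡-Reasoning)
open import Relation.Nullary.Negation using (¬_)

import Algebra.Properties.CommutativeMonoid.Sum ℕ.+-0-commutativeMonoid as Sum

open Func using (to) renaming (cong to to-cong)

Unordered : Setoid 0ℓ 0ℓ → Setoid 0ℓ 0ℓ
Unordered S = record
  { Carrier = Carrier × Carrier
  ; _≈_ = λ (a , b) (c , d) → (a ≈ c × b ≈ d) ⊎ (a ≈ d × b ≈ c)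
  ; isEquivalence = record
    { refl  = inj₁ (S.refl , S.refl)
    ; sym   = λ { (inj₁ (p , q)) → inj₁ (S.sym p , S.sym q)
                ; (inj₂ (p , q)) → inj₂ (S.sym q , S.sym p) }
    ; trans = λ { (inj₁ (p , q)) (inj₁ (r , s)) → inj₁ (S.trans p r , S.trans q s)
                ; (inj₁ (p , q)) (inj₂ (r , s)) → inj₂ (S.trans p r , S.trans q s)
                ; (inj₂ (p , q)) (inj₁ (r , s)) → inj₂ (S.trans p s , S.trans q r)
                ; (inj₂ (p , q)) (inj₂ (r , s)) → inj₁ (S.trans p s , S.trans q r) }
    }
  }
  where
  module S = Setoid S
  open S using (Carrier; _≈_)

unordered-map : ∀ {S T} → Func S T → Func (Unordered S) (Unordered T)
unordered-map f = record
  { to   = λ (a , b) → to f a , to f b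
  ; cong = λ { (inj₁ (p , q)) → inj₁ (to-cong f p , to-cong f q)
             ; (inj₂ (p , q)) → inj₂ (to-cong f p , to-cong f q) }
  }

-- Undirected, with loops and parallel edges; "the same vertex" and "the same
-- edge" are setoid equalities.
record Multigraph : Set₁ where
  field
    V    : Setoid 0ℓ 0ℓ
    E    : Setoid 0ℓ 0ℓ
    ends : Func E (Unordered V)

  Vertex Edge : Set
  Vertex = Setoid.Carrier V
  Edge   = Setoid.Carrier E

  Joins : Edge → Vertex → Vertex → Set
  Joins e u v = Setoid._≈_ (Unordered V) (to ends e) (u , v)

open Multigraph public using (V; E; ends; Vertex; Edge; Joins)

record Hom (Γ Δ : Multigraph) : Set where
  field
    onV : Func (V Γ) (V Δ)
    onE : Func (E Γ) (E Δ)
    onEnds : ∀ e → let (u , v) = to (ends Γ) e in Joins Δ (to onE e) (to onV u) (to onV v)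

open Hom public

infix 4 _≅_

record _≅_ (Γ Δ : Multigraph) : Set where
  field
    V-iso : Inverse (V Γ) (V Δ)
    E-iso : Inverse (E Γ) (E Δ)
    ends-iso : ∀ e → let (u , v) = to (ends Γ) e in
               Joins Δ (Inverse.to E-iso e) (Inverse.to V-iso u) (Inverse.to V-iso v)

-- For a symmetric irreflexive relation this is the simple graph with that
-- adjacency: its edges are unordered pairs of adjacent vertices.
simpleGraph : (S : Setoid 0ℓ 0ℓ) → Rel (Setoid.Carrier S) 0ℓ → Multigraph
simpleGraph S Adj = record
  { V    = S
  ; E    = On.setoid {B = ∃₂ Adj} (Unordered S) (λ (u , v , _) → u , v)
  ; ends = record { to = λ (u , v , _) → u , v ; cong = λ p → p }
  }

simpleHom : ∀ {S Adj} (f : Func S S) → (∀ {u v} → Adj u v → Adj (to f u) (to f v)) →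
            Hom (simpleGraph S Adj) (simpleGraph S Adj)
simpleHom {S} f adj = record
  { onV = f
  ; onE = record
    { to   = λ (u , v , a) → to f u , to f v , adj a
    ; cong = to-cong (unordered-map f)
    }
  ; onEnds = λ _ → Setoid.refl (Unordered S)
  }

-- The axioms make every act g invertible, hence an automorphism.
record Action (𝔾 : Group 0ℓ 0ℓ) (Γ : Multigraph) : Set where
  private
    module G = Group 𝔾
    module V = Setoid (V Γ)
    module E = Setoid (E Γ)
  field
    act : G.Carrier → Hom Γ Γ

  infixr 6 _·_ _·ᵉ_

  _·_ : G.Carrier → Vertex Γ → Vertex Γ
  g · v = to (onV (act g)) v

  _·ᵉ_ : G.Carrier → Edge Γ → Edge Γ
  g ·ᵉ e = to (onE (act g)) e

  field
    ·-cong : ∀ {g h} → g G.≈ h → ∀ v → g · v V.≈ h · v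
    ·-ε    : ∀ v → G.ε · v V.≈ v
    ·-∙    : ∀ g h v → (g G.∙ h) · v V.≈ g · h · v

    ·ᵉ-cong : ∀ {g h} → g G.≈ h → ∀ e → g ·ᵉ e E.≈ h ·ᵉ e
    ·ᵉ-ε    : ∀ e → G.ε ·ᵉ e E.≈ e
    ·ᵉ-∙    : ∀ g h e → (g G.∙ h) ·ᵉ e E.≈ g ·ᵉ h ·ᵉ e

module _ {𝔾 : Group 0ℓ 0ℓ} where
  private module G = Group 𝔾

  orbits : (S : Setoid 0ℓ 0ℓ) (let open Setoid S) (f : G.Carrier → Func S S) →
           (∀ {g h} → g G.≈ h → ∀ x → to (f g) x ≈ to (f h) x) →
           (∀ x → to (f G.ε) x ≈ x) →
           (∀ g h x → to (f (g G.∙ h)) x ≈ to (f g) (to (f h) x)) →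
           Setoid 0ℓ 0ℓ
  orbits S f f-cong f-ε f-∙ = record
    { Carrier = S.Carrier
    ; _≈_ = λ x y → ∃[ g ] to (f g) x S.≈ y
    ; isEquivalence = record
      { refl  = G.ε , f-ε _
      ; sym   = λ { {x} (g , p) → g G.⁻¹ ,
                    S.trans (to-cong (f (g G.⁻¹)) (S.sym p))
                   (S.trans (S.sym (f-∙ (g G.⁻¹) g x))
                   (S.trans (f-cong (G.inverseˡ g) x) (f-ε x))) }
      ; trans = λ { {x} (g , p) (h , q) → h G.∙ g ,
                    S.trans (f-∙ h g x) (S.trans (to-cong (f h) p) q) }
      }
    }
    where module S = Setoid S

  infixl 7 _/_

  _/_ : (Γ : Multigraph) → Action 𝔾 Γ → Multigraph
  Γ / Υ = record
    { V    = orbits (V Γ) (onV ∘ act) ·-cong ·-ε ·-∙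
    ; E    = orbits (E Γ) (onE ∘ act) ·ᵉ-cong ·ᵉ-ε ·ᵉ-∙
    ; ends = record
      { to   = to (ends Γ)
      ; cong = λ { {e} (g , p) →
          shift g (Setoid.trans (Unordered (V Γ))
                    (Setoid.sym (Unordered (V Γ)) (onEnds (act g) e))
                    (to-cong (ends Γ) p)) }
      }
    }
    where
    open Action Υ
    module V = Setoid (V Γ)
    shift : ∀ g {a b c d} → Setoid._≈_ (Unordered (V Γ)) (g · a , g · b) (c , d) →
            Setoid._≈_ (Unordered (orbits (V Γ) (onV ∘ act) ·-cong ·-ε ·-∙)) (a , b) (c , d)
    shift g (inj₁ (p , q)) = inj₁ ((g , p) , (g , q))
    shift g (inj₂ (p , q)) = inj₂ ((g , p) , (g , q))

  simpleAction : ∀ {S Adj} (let open Setoid S) (f : G.Carrier → Func S S) →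
                 (∀ g {u v} → Adj u v → Adj (to (f g) u) (to (f g) v)) →
                 (∀ {g h} → g G.≈ h → ∀ x → to (f g) x ≈ to (f h) x) →
                 (∀ x → to (f G.ε) x ≈ x) →
                 (∀ g h x → to (f (g G.∙ h)) x ≈ to (f g) (to (f h) x)) →
                 Action 𝔾 (simpleGraph S Adj)
  simpleAction f adj f-cong f-ε f-∙ = record
    { act     = λ g → simpleHom (f g) (adj g)
    ; ·-cong  = f-cong
    ; ·-ε     = f-ε
    ; ·-∙     = f-∙
    ; ·ᵉ-cong = λ p (u , v , _) → inj₁ (f-cong p u , f-cong p v)
    ; ·ᵉ-ε    = λ (u , v , _) → inj₁ (f-ε u , f-ε v)
    ; ·ᵉ-∙    = λ g h (u , v , _) → inj₁ (f-∙ g h u , f-∙ g h v)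
    }

  induced : ∀ {Γ} (Υ : Action 𝔾 Γ) (let open Action Υ) (f : Hom Γ Γ) (θ : G.Carrier → G.Carrier) →
            (∀ g v → Setoid._≈_ (V Γ) (θ g · to (onV f) v) (to (onV f) (g · v))) →
            (∀ g e → Setoid._≈_ (E Γ) (θ g ·ᵉ to (onE f) e) (to (onE f) (g ·ᵉ e))) →
            Hom (Γ / Υ) (Γ / Υ)
  induced {Γ} Υ f θ commV commE = record
    { onV = record
      { to   = to (onV f)
      ; cong = λ { {u} (g , p) → θ g , Setoid.trans (V Γ) (commV g u) (to-cong (onV f) p) } }
    ; onE = record
      { to   = to (onE f)
      ; cong = λ { {e} (g , p) → θ g , Setoid.trans (E Γ) (commE g e) (to-cong (onE f) p) } }
    ; onEnds = λ e → coarsen (onEnds f e)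
    }
    where
    open Action Υ
    up : ∀ {a b} → Setoid._≈_ (V Γ) a b → Setoid._≈_ (V (Γ / Υ)) a b
    up p = G.ε , Setoid.trans (V Γ) (·-ε _) p
    coarsen : ∀ {a b} → Setoid._≈_ (Unordered (V Γ)) a b → Setoid._≈_ (Unordered (V (Γ / Υ))) a b
    coarsen (inj₁ (p , q)) = inj₁ (up p , up q)
    coarsen (inj₂ (p , q)) = inj₂ (up p , up q)

-- Folding a multigraph Q along an involution ℵ: vertices v and ℵ v are paired,
-- skew edges e and ℵ e are paired, each horizontal edge becomes one loop. The pairs of
-- vertices are named by those members [ A ] that carry a label.

module Folding (Q : Multigraph) (ℵ : Hom Q Q)
               (involutive : ∀ v → Setoid._≈_ (V Q) (to (onV ℵ) (to (onV ℵ) v)) v)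
               (Label : Set) ([_] : Label → Vertex Q) where

  Horizontal : Edge Q → Set
  Horizontal e = ∃[ v ] Joins Q e v (to (onV ℵ) v)

  Skew : Edge Q → Set
  Skew e = ¬ Horizontal e

  private
    ℵ′ : Vertex Q → Vertex Q
    ℵ′ = to (onV ℵ)

    module W = Setoid (V Q)
    module U = Setoid (Unordered (V Q))

    ℵ′-cancel : ∀ {u v} → ℵ′ u W.≈ ℵ′ v → u W.≈ v
    ℵ′-cancel {u} {v} p = W.trans (W.sym (involutive u)) (W.trans (to-cong (onV ℵ) p) (involutive v))

  -- Labels A, up to equality of the unordered pairs ⟨A⟩ = {[ A ] , ℵ [ A ]}.
  Pairs : Setoid 0ℓ 0ℓ
  Pairs = On.setoid {B = Label} (Unordered (V Q)) (λ A → [ A ] , ℵ′ [ A ])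

  -- A skew edge e joining [ A ] to ℵ [ A′ ] represents the pair {e , ℵ e}.
  record SkewEdge : Set where
    field
      A A′  : Label
      edge  : Edge Q
      joins : Joins Q edge [ A ] (ℵ′ [ A′ ])
      skew  : Skew edge

  record HorizontalEdge : Set where
    field
      A     : Label
      edge  : Edge Q
      joins : Joins Q edge [ A ] (ℵ′ [ A ])

  SkewPairs : Setoid 0ℓ 0ℓ
  SkewPairs = On.setoid {B = SkewEdge} (Unordered (E Q)) (λ e → edge e , to (onE ℵ) (edge e))
    where open SkewEdge

  HorizontalEdges : Setoid 0ℓ 0ℓ
  HorizontalEdges = On.setoid {B = HorizontalEdge} (E Q) HorizontalEdge.edge

  private
    sameClass : ∀ {A B} → [ A ] W.≈ [ B ] → Setoid._≈_ Pairs A B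
    sameClass p = inj₁ (p , to-cong (onV ℵ) p)

    mateClass : ∀ {A B} → [ A ] W.≈ ℵ′ [ B ] → Setoid._≈_ Pairs A B
    mateClass {A} {B} p = inj₂ (p , W.trans (to-cong (onV ℵ) p) (involutive [ B ]))

    skewEnds : Func SkewPairs (Unordered Pairs)
    skewEnds = record
      { to   = λ e → A e , A′ e
      ; cong = λ { {e} {f} (inj₁ (p , _)) → direct {A e} {A′ e} {A f} {A′ f}
                     (U.trans (U.sym (joins e)) (U.trans (to-cong (ends Q) p) (joins f)))
                 ; {e} {f} (inj₂ (p , _)) → crossed {A e} {A′ e} {A f} {A′ f}
                     (U.trans (U.sym (joins e)) (U.trans (to-cong (ends Q) p)
                       (U.trans (onEnds ℵ (edge f)) (to-cong (unordered-map (onV ℵ)) (joins f))))) }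
      }
      where
      open SkewEdge

      direct : ∀ {A A′ B B′} → ([ A ] , ℵ′ [ A′ ]) U.≈ ([ B ] , ℵ′ [ B′ ]) →
               Setoid._≈_ (Unordered Pairs) (A , A′) (B , B′)
      direct {A} {A′} {B} {B′} (inj₁ (p , q)) =
        inj₁ (sameClass {A} {B} p , sameClass {A′} {B′} (ℵ′-cancel q))
      direct {A} {A′} {B} {B′} (inj₂ (p , q)) =
        inj₂ (mateClass {A} {B′} p , Setoid.sym Pairs {B} {A′} (mateClass {B} {A′} (W.sym q)))

      crossed : ∀ {A A′ B B′} → ([ A ] , ℵ′ [ A′ ]) U.≈ (ℵ′ [ B ] , ℵ′ (ℵ′ [ B′ ])) →
                Setoid._≈_ (Unordered Pairs) (A , A′) (B , B′)
      crossed {A} {A′} {B} {B′} (inj₁ (p , q)) =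
        inj₁ (mateClass {A} {B} p , mateClass {A′} {B′} (ℵ′-cancel q))
      crossed {A} {A′} {B} {B′} (inj₂ (p , q)) =
        inj₂ (sameClass {A} {B′} (W.trans p (involutive [ B′ ])) , sameClass {A′} {B} (ℵ′-cancel q))

    horizontalEnds : Func HorizontalEdges (Unordered Pairs)
    horizontalEnds = record
      { to   = λ e → A e , A e
      ; cong = λ {e} {f} p →
          let q = U.trans (U.sym (joins e)) (U.trans (to-cong (ends Q) p) (joins f))
          in inj₁ (q , q)
      }
      where open HorizontalEdge

  fold : Multigraph
  fold = record
    { V    = Pairs
    ; E    = SkewPairs ⊎ₛ HorizontalEdges
    ; ends = record
      { to   = [ to skewEnds , to horizontalEnds ]′
      ; cong = λ { (inj₁ {e} {f} p) → to-cong skewEnds {e} {f} p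
                 ; (inj₂ {e} {f} p) → to-cong horizontalEnds {e} {f} p }
      }
    }

module _ (n : ℕ) .{{_ : NonZero n}} where
  private
    infixl 6 _⊕_

    _⊕_ : Fin n → Fin n → Fin n
    i ⊕ j = (toℕ i + toℕ j) mod n

    ⊖_ : Fin n → Fin n
    ⊖ i = (n ∸ toℕ i) mod n

    toℕ-mod : ∀ m → toℕ (m mod n) ≡ m % n
    toℕ-mod m = toℕ-fromℕ< (m%n<n m n)

    mod-cong : ∀ {m o} → m % n ≡ o % n → m mod n ≡ o mod n
    mod-cong {m} {o} p = toℕ-injective (trans (toℕ-mod m) (trans p (sym (toℕ-mod o))))

    mod-+ˡ : ∀ m o → (toℕ (m mod n) + o) mod n ≡ (m + o) mod n
    mod-+ˡ m o = mod-cong (begin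
      (toℕ (m mod n) + o) % n    ≡⟨ cong (λ x → (x + o) % n) (toℕ-mod m) ⟩
      (m % n + o) % n            ≡⟨ %-distribˡ-+ (m % n) o n ⟩
      (m % n % n + o % n) % n    ≡⟨ cong (λ x → (x + o % n) % n) (m%n%n≡m%n m n) ⟩
      (m % n + o % n) % n        ≡⟨ %-distribˡ-+ m o n ⟨
      (m + o) % n                ∎)
      where open ≡-Reasoning

    ⊕-comm : ∀ i j → i ⊕ j ≡ j ⊕ i
    ⊕-comm i j = cong (_mod n) (ℕ.+-comm (toℕ i) (toℕ j))

    ⊕-assoc : ∀ i j l → (i ⊕ j) ⊕ l ≡ i ⊕ (j ⊕ l)
    ⊕-assoc i j l = begin
      (i ⊕ j) ⊕ l                              ≡⟨ mod-+ˡ (toℕ i + toℕ j) (toℕ l) ⟩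
      (toℕ i + toℕ j + toℕ l) mod n            ≡⟨ cong (_mod n) (ℕ.+-assoc (toℕ i) _ _) ⟩
      (toℕ i + (toℕ j + toℕ l)) mod n          ≡⟨ cong (_mod n) (ℕ.+-comm (toℕ i) _) ⟩
      (toℕ j + toℕ l + toℕ i) mod n            ≡⟨ mod-+ˡ (toℕ j + toℕ l) (toℕ i) ⟨
      (j ⊕ l) ⊕ i                              ≡⟨ ⊕-comm (j ⊕ l) i ⟩
      i ⊕ (j ⊕ l)                              ∎
      where open ≡-Reasoning

    ⊕-identityˡ : ∀ i → (0 mod n) ⊕ i ≡ i
    ⊕-identityˡ i = trans (mod-+ˡ 0 (toℕ i))
      (toℕ-injective (trans (toℕ-mod (toℕ i)) (m<n⇒m%n≡m (toℕ<n i))))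

    ⊕-inverseˡ : ∀ i → (⊖ i) ⊕ i ≡ 0 mod n
    ⊕-inverseˡ i = begin
      (⊖ i) ⊕ i                   ≡⟨ mod-+ˡ (n ∸ toℕ i) (toℕ i) ⟩
      (n ∸ toℕ i + toℕ i) mod n   ≡⟨ cong (_mod n) (ℕ.m∸n+n≡m (ℕ.<⇒≤ (toℕ<n i))) ⟩
      n mod n                     ≡⟨ mod-cong (trans (n%n≡0 n) (sym (m<n⇒m%n≡m (>-nonZero⁻¹ n)))) ⟩
      0 mod n                     ∎
      where open ≡-Reasoning

  ℤmod : AbelianGroup 0ℓ 0ℓ
  ℤmod = record
    { Carrier = Fin n
    ; _≈_ = _≡_
    ; _∙_ = _⊕_
    ; ε = 0 mod n
    ; _⁻¹ = ⊖_
    ; isAbelianGroup = record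
      { isGroup = record
        { isMonoid = record
          { isSemigroup = record
            { isMagma = record { isEquivalence = isEquivalence ; ∙-cong = cong₂ _⊕_ }
            ; assoc = ⊕-assoc
            }
          ; identity = ⊕-identityˡ , λ i → trans (⊕-comm i _) (⊕-identityˡ i)
          }
        ; inverse = ⊕-inverseˡ , λ i → trans (⊕-comm i _) (⊕-inverseˡ i)
        ; ⁻¹-cong = cong ⊖_
        }
      ; comm = ⊕-comm
      }
    }

  opposite≡ : ∀ i → (let open AbelianGroup ℤmod) → opposite i ≡ ((n ∸ 1) mod n) ∙ i ⁻¹
  opposite≡ i = trans (sym (//-rightDividesʳ i (opposite i))) (cong (λ m → (m mod n) ∙ i ⁻¹) sum≡)
    where
    open AbelianGroup ℤmod using (_∙_; _⁻¹)
    open AbelianGroupProperties ℤmod using (//-rightDividesʳ)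
    sum≡ : toℕ (opposite i) + toℕ i ≡ n ∸ 1
    sum≡ = trans (cong (_+ toℕ i) (opposite-prop i))
      (trans (cong (_+ toℕ i) (sym (ℕ.∸-+-assoc n 1 (toℕ i))))
             (ℕ.m∸n+n≡m (toℕ≤pred[n] i)))

-- Pairs (i , s) stand for rⁱ (s = +) or rⁱ·σ (s = -), where rⁿ = σ² = 1 and
-- σ·r = r⁻¹·σ; the group has order 2n.
Dihedral : (n : ℕ) .{{_ : NonZero n}} → Group 0ℓ 0ℓ
Dihedral n = record
  { Carrier = Fin n × Sign
  ; _≈_ = _≡_
  ; _∙_ = _∙ᵈ_
  ; ε = ε , Sign.+
  ; _⁻¹ = inv
  ; isGroup = record
    { isMonoid = record
      { isSemigroup = record
        { isMagma = record { isEquivalence = isEquivalence ; ∙-cong = cong₂ _∙ᵈ_ }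
        ; assoc = λ (i , s) (j , t) (l , u) → cong₂ _,_
            (trans (assoc i (s ◃ j) ((s Sign.* t) ◃ l))
              (cong (i ∙_) (trans (cong ((s ◃ j) ∙_) (◃-* s t l)) (sym (◃-∙ s j (t ◃ l))))))
            (Sign.*-assoc s t u)
        }
      ; identity = (λ (i , s) → cong₂ _,_ (identityˡ i) refl)
                 , (λ (i , s) → cong₂ _,_ (trans (cong (i ∙_) (◃-ε s)) (identityʳ i)) (Sign.*-identityʳ s))
      }
    ; inverse = (λ (i , s) → cong₂ _,_ (trans (sym (◃-∙ s (i ⁻¹) i)) (trans (cong (s ◃_) (inverseˡ i)) (◃-ε s))) (Sign.s*s≡+ s))
              , (λ (i , s) → cong₂ _,_ (trans (cong (i ∙_) (trans (sym (◃-* s s (i ⁻¹))) (cong (_◃ (i ⁻¹)) (Sign.s*s≡+ s)))) (inverseʳ i)) (Sign.s*s≡+ s))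
    ; ⁻¹-cong = cong inv
    }
  }
  where
  open AbelianGroup (ℤmod n)
    using (_∙_; _⁻¹; ε; assoc; identityˡ; identityʳ; inverseˡ; inverseʳ)
  open AbelianGroupProperties (ℤmod n)

  _◃_ : Sign → Fin n → Fin n
  Sign.+ ◃ j = j
  Sign.- ◃ j = j ⁻¹

  _∙ᵈ_ : Fin n × Sign → Fin n × Sign → Fin n × Sign
  (i , s) ∙ᵈ (j , t) = i ∙ (s ◃ j) , s Sign.* t

  inv : Fin n × Sign → Fin n × Sign
  inv (i , s) = s ◃ (i ⁻¹) , s

  ◃-ε : ∀ s → s ◃ ε ≡ ε
  ◃-ε Sign.+ = refl
  ◃-ε Sign.- = ε⁻¹≈ε

  ◃-∙ : ∀ s i j → s ◃ (i ∙ j) ≡ (s ◃ i) ∙ (s ◃ j)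
  ◃-∙ Sign.+ i j = refl
  ◃-∙ Sign.- i j = sym (⁻¹-∙-comm i j)

  ◃-* : ∀ s t i → (s Sign.* t) ◃ i ≡ s ◃ (t ◃ i)
  ◃-* Sign.+ t i = refl
  ◃-* Sign.- Sign.+ i = refl
  ◃-* Sign.- Sign.- i = sym (⁻¹-involutive i)

DifferOnce : ∀ {n} → Rel (Subset n) 0ℓ
DifferOnce u v = ∃! _≡_ λ i → lookup u i ≢ lookup v i

permute : ∀ {n} → Permutation′ n → Subset n → Subset n
permute π b = tabulate λ i → lookup b (π ⟨$⟩ʳ i)

reversal : ∀ {n} → Permutation′ n
reversal = Permutation.reverse

translation : ∀ {n} .{{_ : NonZero n}} → Fin n → Permutation′ n
translation {n} j = permutation (_∙ j) (_∙ j ⁻¹) (λ i → //-rightDividesˡ j i) (λ i → //-rightDividesʳ j i)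
  where
  open AbelianGroup (ℤmod n) using (_∙_; _⁻¹)
  open AbelianGroupProperties (ℤmod n)

∣permute∣ : ∀ {n} (π : Permutation′ n) b → ∣ permute π b ∣ ≡ ∣ b ∣
∣permute∣ {n} π b = begin
  ∣ permute π b ∣                              ≡⟨ ∣∣≡sum (permute π b) ⟩
  Sum.sum (bit ∘ lookup (permute π b))         ≡⟨ Sum.sum-cong-≗ {n} (λ i → cong bit (lookup∘tabulate (λ i → lookup b (π ⟨$⟩ʳ i)) i)) ⟩
  Sum.sum (λ i → bit (lookup b (π ⟨$⟩ʳ i)))    ≡⟨ Sum.sum-permute (bit ∘ lookup b) π ⟨
  Sum.sum (bit ∘ lookup b)                     ≡⟨ ∣∣≡sum b ⟨
  ∣ b ∣                                        ∎
  where
  open ≡-Reasoning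
  bit : Bool → ℕ
  bit b = if b then 1 else 0
  ∣∣≡sum : ∀ {n} (b : Subset n) → ∣ b ∣ ≡ Sum.sum (bit ∘ lookup b)
  ∣∣≡sum []          = refl
  ∣∣≡sum (true  ∷ b) = cong suc (∣∣≡sum b)
  ∣∣≡sum (false ∷ b) = ∣∣≡sum b

permute-differOnce : ∀ {n} (π : Permutation′ n) {u v} → DifferOnce u v → DifferOnce (permute π u) (permute π v)
permute-differOnce π {u} {v} (i , u≢v , unique) =
  π ⟨$⟩ˡ i ,
  (λ p → u≢v (trans (sym (at u)) (trans p (at v)))) ,
  (λ {j} q → trans (cong (π ⟨$⟩ˡ_) (unique λ p → q (trans (lookup∘tabulate _ j) (trans p (sym (lookup∘tabulate _ j))))))
                   (Permutation.inverseˡ π))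
  where
  at : ∀ w → lookup (permute π w) (π ⟨$⟩ˡ i) ≡ lookup w i
  at w = trans (lookup∘tabulate _ (π ⟨$⟩ˡ i)) (cong (lookup w) (Permutation.inverseʳ π))

∁-differOnce : ∀ {n} {u v : Subset n} → DifferOnce u v → DifferOnce (∁ u) (∁ v)
∁-differOnce {u = u} {v} (i , u≢v , unique) =
  i ,
  (λ p → u≢v (not-injective (trans (sym (lookup-map i not u)) (trans p (lookup-map i not v))))) ,
  (λ {j} q → unique λ p → q (trans (lookup-map j not u) (trans (cong not p) (sym (lookup-map j not v)))))

string-ext : ∀ {n} {u v : Subset n} → (∀ i → lookup u i ≡ lookup v i) → u ≡ v
string-ext {u = u} {v} p = trans (sym (tabulate∘lookup u)) (trans (tabulate-cong p) (tabulate∘lookup v))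

translate : ∀ {n} .{{_ : NonZero n}} → Fin n → Subset n → Subset n
translate j = permute (translation j)

complementedReversal : ∀ {n} → Subset n → Subset n
complementedReversal b = ∁ (permute reversal b)

lookup-cr : ∀ {n} (b : Subset n) i → lookup (complementedReversal b) i ≡ not (lookup b (opposite i))
lookup-cr b i = trans (lookup-map i not (permute reversal b)) (cong not (lookup∘tabulate _ i))

complementedReversal-involutive : ∀ {n} (b : Subset n) → complementedReversal (complementedReversal b) ≡ b
complementedReversal-involutive b = string-ext λ i → begin
  lookup (complementedReversal (complementedReversal b)) i   ≡⟨ lookup-cr (complementedReversal b) i ⟩
  not (lookup (complementedReversal b) (opposite i))         ≡⟨ cong not (lookup-cr b (opposite i)) ⟩
  not (not (lookup b (opposite (opposite i))))               ≡⟨ not-involutive _ ⟩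
  lookup b (opposite (opposite i))                           ≡⟨ cong (lookup b) (opposite-involutive i) ⟩
  lookup b i                                                 ∎
  where open ≡-Reasoning

module _ {n : ℕ} .{{_ : NonZero n}} where
  open AbelianGroup (ℤmod n) using (_∙_; _⁻¹; ε; assoc; identityʳ)
  open AbelianGroupProperties (ℤmod n)

  translate-ε : ∀ b → translate ε b ≡ b
  translate-ε b = string-ext λ i → trans (lookup∘tabulate _ i) (cong (lookup b) (identityʳ i))

  translate-∙ : ∀ i j b → translate (i ∙ j) b ≡ translate i (translate j b)
  translate-∙ i j b = string-ext λ l → begin
    lookup (translate (i ∙ j) b) l           ≡⟨ lookup∘tabulate _ l ⟩
    lookup b (l ∙ (i ∙ j))                   ≡⟨ cong (lookup b) (assoc l i j) ⟨
    lookup b (l ∙ i ∙ j)                     ≡⟨ lookup∘tabulate _ (l ∙ i) ⟨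
    lookup (translate j b) (l ∙ i)           ≡⟨ lookup∘tabulate _ l ⟨
    lookup (translate i (translate j b)) l   ∎
    where open ≡-Reasoning

  opposite-∙ : ∀ i j → opposite (i ∙ j ⁻¹) ≡ opposite i ∙ j
  opposite-∙ i j = begin
    opposite (i ∙ j ⁻¹)          ≡⟨ opposite≡ n (i ∙ j ⁻¹) ⟩
    c ∙ (i ∙ j ⁻¹) ⁻¹            ≡⟨ cong (c ∙_) (⁻¹-∙-comm i (j ⁻¹)) ⟨
    c ∙ (i ⁻¹ ∙ (j ⁻¹) ⁻¹)       ≡⟨ cong (λ x → c ∙ (i ⁻¹ ∙ x)) (⁻¹-involutive j) ⟩
    c ∙ (i ⁻¹ ∙ j)               ≡⟨ assoc c (i ⁻¹) j ⟨
    c ∙ i ⁻¹ ∙ j                 ≡⟨ cong (_∙ j) (opposite≡ n i) ⟨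
    opposite i ∙ j               ∎
    where
    open ≡-Reasoning
    c = (n ∸ 1) mod n

  complementedReversal-translate :
    ∀ j b → translate (j ⁻¹) (complementedReversal b) ≡ complementedReversal (translate j b)
  complementedReversal-translate j b = string-ext λ i → begin
    lookup (translate (j ⁻¹) (complementedReversal b)) i   ≡⟨ lookup∘tabulate _ i ⟩
    lookup (complementedReversal b) (i ∙ j ⁻¹)             ≡⟨ lookup-cr b (i ∙ j ⁻¹) ⟩
    not (lookup b (opposite (i ∙ j ⁻¹)))                   ≡⟨ cong (not ∘ lookup b) (opposite-∙ i j) ⟩
    not (lookup b (opposite i ∙ j))                        ≡⟨ cong not (lookup∘tabulate _ (opposite i)) ⟨
    not (lookup (translate j b) (opposite i))              ≡⟨ lookup-cr (translate j b) i ⟨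
    lookup (complementedReversal (translate j b)) i        ∎
    where open ≡-Reasoning

module _ (k : ℕ) where
  private
    n : ℕ
    n = suc (2 * k)

    open module ℤₙ = AbelianGroup (ℤmod n) using (_⁻¹)

  InMiddleLevels : Subset n → Set
  InMiddleLevels b = ∣ b ∣ ≡ k ⊎ ∣ b ∣ ≡ suc k

  MiddleString : Setoid 0ℓ 0ℓ
  MiddleString = On.setoid {B = ∃ InMiddleLevels} (setoid (Subset n)) proj₁

  M : Multigraph
  M = simpleGraph MiddleString λ (u , _) (v , _) → DifferOnce u v

  πAction : Action ℤₙ.group M
  πAction = simpleAction
    (λ j → record
      { to   = λ (b , l) → translate j b , subst (λ w → w ≡ k ⊎ w ≡ suc k) (sym (∣permute∣ (translation j) b)) l
      ; cong = cong (translate j) })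
    (λ j {u} {v} → permute-differOnce (translation j) {proj₁ u} {proj₁ v})
    (λ { refl _ → refl })
    (λ (b , _) → translate-ε b)
    (λ i j (b , _) → translate-∙ i j b)

  M/π : Multigraph
  M/π = M / πAction

  ∣complementedReversal∣ : (b : Subset n) → ∣ complementedReversal b ∣ ≡ n ∸ ∣ b ∣
  ∣complementedReversal∣ b = trans (∣∁p∣≡n∸∣p∣ (permute reversal b)) (cong (n ∸_) (∣permute∣ reversal b))

  complementedReversal-middle : ∀ {b} → InMiddleLevels b → InMiddleLevels (complementedReversal b)
  complementedReversal-middle {b} (inj₁ p) = inj₂ (begin
    ∣ complementedReversal b ∣   ≡⟨ ∣complementedReversal∣ b ⟩
    n ∸ ∣ b ∣                    ≡⟨ cong₂ _∸_ (cong (λ x → suc (k + x)) (ℕ.+-identityʳ k)) p ⟩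
    suc (k + k) ∸ k              ≡⟨ ℕ.m+n∸n≡m (suc k) k ⟩
    suc k                        ∎)
    where open ≡-Reasoning
  complementedReversal-middle {b} (inj₂ p) = inj₁ (begin
    ∣ complementedReversal b ∣   ≡⟨ ∣complementedReversal∣ b ⟩
    n ∸ ∣ b ∣                    ≡⟨ cong₂ _∸_ (cong (λ x → suc (k + x)) (ℕ.+-identityʳ k)) p ⟩
    suc (k + k) ∸ suc k          ≡⟨ ℕ.m+n∸n≡m k k ⟩
    k                            ∎)
    where open ≡-Reasoning

  ℵ : Hom M M
  ℵ = simpleHom
    (record { to = λ (b , l) → complementedReversal b , complementedReversal-middle {b} l
            ; cong = cong complementedReversal })
    (λ {u} {v} d → ∁-differOnce {u = permute reversal (proj₁ u)} {v = permute reversal (proj₁ v)}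
                     (permute-differOnce reversal {proj₁ u} {proj₁ v} d))

  ℵπ : Hom M/π M/π
  ℵπ = induced πAction ℵ _⁻¹
    (λ j (b , _) → complementedReversal-translate j b)
    (λ j ((u , _) , (v , _) , _) → inj₁ (complementedReversal-translate j u , complementedReversal-translate j v))

  ℵπ-involutive : ∀ v → Setoid._≈_ (V M/π) (to (onV ℵπ) (to (onV ℵπ) v)) v
  ℵπ-involutive (b , _) = ℤₙ.ε , trans (translate-ε _) (complementedReversal-involutive b)

  k-Subset : Set
  k-Subset = Σ[ A ∈ Subset n ] ∣ A ∣ ≡ k

  -- The class (B_A).
  class : k-Subset → Vertex M/π
  class (A , ∣A∣≡k) = A , inj₁ ∣A∣≡k

  open Folding M/π ℵπ ℵπ-involutive k-Subset class public renaming (fold to R)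

-- Let the rotations of the dihedral group act by translation and the reflection σ
-- by ℵ. A dihedral orbit is then a π-orbit merged with its image under ℵπ, which is
-- how R is obtained from M/π. The one discrepancy would be a horizontal edge not
-- fixed by ℵπ, since R does not pair horizontal edges; but if w = rʲℵu, then also
-- u = rʲℵw, so rʲℵ exchanges the ends of the edge uw.

module Submission where

open import Defs
open import Algebra.Bundles using (Group; AbelianGroup)
open import Data.Bool.Base using (true; false)
open import Data.Bool.Properties using () renaming (_≟_ to _≟ᵇ_)
open import Data.Fin.Base using (zero; suc)
open import Data.Fin.Properties using (any?; 0≢1+n; suc-injective)
open import Data.Fin.Subset using (Subset; ∣_∣)
open import Data.Nat.Base using (ℕ; suc; _+_; _*_; _∸_; _<_; NonZero)
import Data.Nat.Properties as ℕ
open import Data.Product.Base using (Σ-syntax; ∃-syntax; _,_; proj₁; proj₂; map₂)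
open import Data.Sign.Base as Sign using (Sign)
open import Data.Sum.Base using (_⊎_; inj₁; inj₂; [_,_]′)
open import Data.Sum.Relation.Binary.Pointwise using (inj₁; inj₂)
open import Data.Vec.Base using (_∷_)
open import Data.Vec.Properties using (≡-dec)
open import Function.Bundles using (Func; Bijection)
open import Function.Consequences.Setoid using (strictlySurjective⇒surjective)
import Function.Construct.Composition as Composition
open import Function.Properties.Bijection using (Bijection⇒Inverse)
open import Relation.Binary.Bundles using (Setoid)
open import Relation.Binary.PropositionalEquality
  using (_≡_; _≢_; refl; sym; trans; cong; module ≡-Reasoning)
open import Relation.Nullary.Decidable as Dec using (Dec; decidable-stable; toSum)
open import Relation.Nullary.Negation using (contradiction)

open Func using (to) renaming (cong to to-cong)

-- Weights of adjacent strings, and squares of reflections.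

differOnce-∣∣ : ∀ {n} (u v : Subset n) → DifferOnce u v → ∣ u ∣ ≢ ∣ v ∣
differOnce-∣∣ (true  ∷ u) (true  ∷ v) (zero  , d , _) _ = d refl
differOnce-∣∣ (false ∷ u) (false ∷ v) (zero  , d , _) _ = d refl
differOnce-∣∣ (true  ∷ u) (true  ∷ v) (suc i , d , unique) eq =
  differOnce-∣∣ u v (i , d , λ {j} q → suc-injective (unique {suc j} q)) (ℕ.suc-injective eq)
differOnce-∣∣ (false ∷ u) (false ∷ v) (suc i , d , unique) eq =
  differOnce-∣∣ u v (i , d , λ {j} q → suc-injective (unique {suc j} q)) eq
differOnce-∣∣ (true  ∷ u) (false ∷ v) (i , _ , unique) eq = ℕ.1+n≢n (trans eq (cong ∣_∣ (sym u≡v)))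
  where
  u≡v : u ≡ v
  -- The heads differ, so `i` is `zero`; a difference at `suc j` would also be at `i`. Hence the
  -- tails agree and the weights differ by exactly one.
  u≡v = string-ext λ j → decidable-stable (_ ≟ᵇ _) λ q →
    0≢1+n (trans (sym (unique {zero} λ ())) (unique {suc j} q))
differOnce-∣∣ (false ∷ u) (true  ∷ v) (i , _ , unique) eq = ℕ.1+n≢n (trans (sym eq) (cong ∣_∣ u≡v))
  where
  u≡v : u ≡ v
  u≡v = string-ext λ j → decidable-stable (_ ≟ᵇ _) λ q →
    0≢1+n (trans (sym (unique {zero} λ ())) (unique {suc j} q))

-- Moving `complementedReversal` past a translation inverts the translation, so the two translations
-- cancel: every `rʲ·σ` has order dividing two.
reflection-involutive : ∀ {n} .{{_ : NonZero n}} j (b : Subset n) →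
  translate j (complementedReversal (translate j (complementedReversal b))) ≡ b
reflection-involutive {n} j b = begin
  translate j (cr (translate j (cr b)))       ≡⟨ cong (translate j) (complementedReversal-translate j (cr b)) ⟨
  translate j (translate (j ⁻¹) (cr (cr b)))  ≡⟨ translate-∙ j (j ⁻¹) (cr (cr b)) ⟨
  translate (j ∙ j ⁻¹) (cr (cr b))            ≡⟨ cong (λ i → translate i (cr (cr b))) (inverseʳ j) ⟩
  translate ε (cr (cr b))                     ≡⟨ translate-ε (cr (cr b)) ⟩
  cr (cr b)                                   ≡⟨ complementedReversal-involutive b ⟩
  b                                           ∎
  where
  open ≡-Reasoning
  open AbelianGroup (ℤmod n) using (_∙_; _⁻¹; ε; inverseʳ)
  cr : ∀ {n} → Subset n → Subset n
  cr = complementedReversal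

module _ (k : ℕ) where
  private
    n : ℕ
    n = suc (2 * k)

    open AbelianGroup (ℤmod n) using (_∙_; _⁻¹; ε)
    module D = Group (Dihedral n)
    module πA = Action (πAction k)
    module W = Setoid (V (M/π k))
    module U = Setoid (Unordered (V (M/π k)))
    module F = Setoid (E (M/π k))
    module FU = Setoid (Unordered (E (M/π k)))

    module S = SkewEdge k
    module H = HorizontalEdge k

    ℵᵛ : Vertex (M k) → Vertex (M k)
    ℵᵛ = to (onV (ℵ k))

    ℵᵉ : Edge (M k) → Edge (M k)
    ℵᵉ = to (onE (ℵ k))

  -- The action of the dihedral group.

  dihedralAct : D.Carrier → Func (MiddleString k) (MiddleString k)
  dihedralAct (j , Sign.+) = onV (πA.act j)
  dihedralAct (j , Sign.-) = Composition.function (onV (ℵ k)) (onV (πA.act j))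

  dihedralAct-∙ : ∀ g h v → proj₁ (to (dihedralAct (g D.∙ h)) v) ≡ proj₁ (to (dihedralAct g) (to (dihedralAct h) v))
  dihedralAct-∙ (i , Sign.+) (j , Sign.+) (b , _) = translate-∙ i j b
  dihedralAct-∙ (i , Sign.+) (j , Sign.-) (b , _) = translate-∙ i j (complementedReversal b)
  -- The relation `σ·r = r⁻¹·σ` appears here as `complementedReversal-translate`.
  dihedralAct-∙ (i , Sign.-) (j , Sign.+) (b , _) =
    trans (translate-∙ i (j ⁻¹) (complementedReversal b))
          (cong (translate i) (complementedReversal-translate j b))
  dihedralAct-∙ (i , Sign.-) (j , Sign.-) (b , _) =
    -- The product is a rotation, in which no reversal is visible; a cancelling pair is inserted so
    -- that one of them can be moved past `j`.
    trans (cong (translate (i ∙ j ⁻¹)) (sym (complementedReversal-involutive b)))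
   (trans (translate-∙ i (j ⁻¹) (complementedReversal (complementedReversal b)))
          (cong (translate i) (complementedReversal-translate j (complementedReversal b))))

  dihedralAction : Action (Dihedral n) (M k)
  dihedralAction = simpleAction
    dihedralAct
    (λ { (j , Sign.+) {u} {v} d → permute-differOnce (translation j) {proj₁ u} {proj₁ v} d
       ; (j , Sign.-) {u} {v} d → permute-differOnce (translation j) {proj₁ (ℵᵛ u)} {proj₁ (ℵᵛ v)}
           (proj₂ (proj₂ (ℵᵉ (u , v , d)))) })
    (λ { refl _ → refl })
    (λ (b , _) → translate-ε b)
    dihedralAct-∙

  -- Dihedral orbits as translation orbits merged along `ℵ`.

  private
    module P = Setoid (V (M k / dihedralAction))
    module G = Setoid (E (M k / dihedralAction))

  ℵᵛ-swap : ∀ {u v} → ℵᵛ u W.≈ v → u W.≈ ℵᵛ v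
  ℵᵛ-swap {u} {v} p =
    W.trans {u} {ℵᵛ (ℵᵛ u)} {ℵᵛ v} (W.sym {ℵᵛ (ℵᵛ u)} {u} (ℵπ-involutive k u))
      (to-cong (onV (ℵπ k)) {ℵᵛ u} {v} p)

  ℵᵉ-involutive : ∀ e → ℵᵉ (ℵᵉ e) F.≈ e
  ℵᵉ-involutive ((u , _) , (v , _) , _) = ε , inj₁
    ( trans (translate-ε _) (complementedReversal-involutive u)
    , trans (translate-ε _) (complementedReversal-involutive v) )

  ℵᵉ-swap : ∀ {e f} → ℵᵉ e F.≈ f → e F.≈ ℵᵉ f
  ℵᵉ-swap {e} {f} p =
    F.trans {e} {ℵᵉ (ℵᵉ e)} {ℵᵉ f} (F.sym {ℵᵉ (ℵᵉ e)} {e} (ℵᵉ-involutive e))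
      (to-cong (onE (ℵπ k)) {ℵᵉ e} {f} p)

  -- The two ways for unordered pairs to agree are the two signs of a group element: `rʲ·σ` takes
  -- `u` to `v` exactly when `rʲ` takes `ℵᵛ u` to `v`.
  mergeᵛ : ∀ {u v} → (u , ℵᵛ u) U.≈ (v , ℵᵛ v) → u P.≈ v
  mergeᵛ (inj₁ ((j , p) , _)) = (j , Sign.+) , p
  mergeᵛ (inj₂ (_ , (j , p))) = (j , Sign.-) , p

  splitᵛ : ∀ {u v} → u P.≈ v → (u , ℵᵛ u) U.≈ (v , ℵᵛ v)
  splitᵛ {u} {v} ((j , Sign.+) , p) = inj₁ ((j , p) , to-cong (onV (ℵπ k)) {u} {v} (j , p))
  splitᵛ {u} {v} ((j , Sign.-) , p) = inj₂ (ℵᵛ-swap {u} {v} (j , p) , (j , p))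

  coarsen : ∀ {u v} → u W.≈ v → u P.≈ v
  coarsen (j , p) = (j , Sign.+) , p

  coarsen-ℵ : ∀ {u v} → u W.≈ ℵᵛ v → u P.≈ v
  coarsen-ℵ {u} {v} p =
    mergeᵛ {u} {v} (inj₂ (p , W.sym {v} {ℵᵛ u} (ℵᵛ-swap {v} {u} (W.sym {u} {ℵᵛ v} p))))

  mergeᵉ : ∀ {e f} → (e , ℵᵉ e) FU.≈ (f , ℵᵉ f) → e G.≈ f
  mergeᵉ (inj₁ ((j , p) , _)) = (j , Sign.+) , p
  mergeᵉ (inj₂ (_ , (j , p))) = (j , Sign.-) , p

  splitᵉ : ∀ {e f} → e G.≈ f → (e , ℵᵉ e) FU.≈ (f , ℵᵉ f)
  splitᵉ {e} {f} ((j , Sign.+) , p) = inj₁ ((j , p) , to-cong (onE (ℵπ k)) {e} {f} (j , p))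
  splitᵉ {e} {f} ((j , Sign.-) , p) = inj₂ (ℵᵉ-swap {e} {f} (j , p) , (j , p))

  -- Horizontal edges and their orbits.

  horizontal⇒reflected : ∀ (e : Edge (M k)) (let (u , v , _) = e) → Horizontal k e → ℵᵛ u W.≈ v
  horizontal⇒reflected (u , v , _) (w , inj₁ (p , q)) =
    W.trans {ℵᵛ u} {ℵᵛ w} {v} (to-cong (onV (ℵπ k)) {u} {w} p) (W.sym {v} {ℵᵛ w} q)
  horizontal⇒reflected (u , v , _) (w , inj₂ (p , q)) =
    W.sym {v} {ℵᵛ u} (W.trans {v} {w} {ℵᵛ u} q (ℵᵛ-swap {w} {u} (W.sym {u} {ℵᵛ w} p)))

  -- An edge is horizontal iff some translation takes `ℵᵛ u` to `v`, and there are only finitely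
  -- many translations to try. Sorting the edges of `M` into skew edges and loops of `R` rests on
  -- this decision.
  horizontal? : ∀ e → Dec (Horizontal k e)
  horizontal? e@(u , v , _) = Dec.map′
    (λ p → u , inj₁ (W.refl {u} , W.sym {ℵᵛ u} {v} p))
    (horizontal⇒reflected e)
    (any? λ j → ≡-dec _≟ᵇ_ (proj₁ (j πA.· ℵᵛ u)) (proj₁ v))

  horizontal-resp : ∀ {e f} → e F.≈ f → Horizontal k f → Horizontal k e
  horizontal-resp {e} {f} p (w , q) = w ,
    U.trans {to (ends (M/π k)) e} {to (ends (M/π k)) f} {w , ℵᵛ w} (to-cong (ends (M/π k)) {e} {f} p) q

  horizontal-ℵ : ∀ {e} → Horizontal k e → Horizontal k (ℵᵉ e)
  horizontal-ℵ {e} (w , q) = ℵᵛ w ,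
    to-cong (unordered-map (onV (ℵπ k))) {to (ends (M/π k)) e} {w , ℵᵛ w} q

  horizontal-fixed : ∀ {e} → Horizontal k e → ℵᵉ e F.≈ e
  horizontal-fixed {e@((u , _) , (v , _) , _)} h with horizontal⇒reflected e h
  -- The translation by `j` takes `ℵ u` to `v`, hence also `ℵ v` to `u`: it carries `ℵᵉ e` to `e`
  -- with the ends exchanged.
  ... | j , refl = j , inj₂ (refl , reflection-involutive j u)

  -- Keeps skew edges and loops of `R` apart in the dihedral quotient: `e` is a translate of `f` or
  -- of `ℵᵉ f`, and both of these are horizontal.
  horizontal-orbit : ∀ {e f} → e G.≈ f → Horizontal k f → Horizontal k e
  horizontal-orbit {e} {f} p h with splitᵉ {e} {f} p
  ... | inj₁ (q , _) = horizontal-resp {e} {f} q h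
  ... | inj₂ (q , _) = horizontal-resp {e} {ℵᵉ f} q (horizontal-ℵ {f} h)

  -- Because `ℵπ` fixes horizontal edges, reflections merge no two of their classes. Loops, which
  -- `R` does not pair, are therefore still counted with the right multiplicity.
  horizontal-orbit-injective : ∀ {e f} → e G.≈ f → Horizontal k f → e F.≈ f
  horizontal-orbit-injective {e} {f} p h with splitᵉ {e} {f} p
  ... | inj₁ (q , _) = q
  ... | inj₂ (q , _) = F.trans {e} {ℵᵉ f} {f} q (horizontal-fixed {f} h)

  -- Labels for vertices and edges.

  complement : (b : Subset n) → ∣ b ∣ ≡ suc k → k-Subset k
  complement b p = complementedReversal b , (begin
    ∣ complementedReversal b ∣   ≡⟨ ∣complementedReversal∣ k b ⟩
    n ∸ ∣ b ∣                    ≡⟨ cong (n ∸_) p ⟩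
    -- By computation `n` and `suc k` each lose a successor, and `2 * k` unfolds to `k + (k + 0)`.
    2 * k ∸ k                    ≡⟨ ℕ.m+n∸m≡n k (k + 0) ⟩
    k + 0                        ≡⟨ ℕ.+-identityʳ k ⟩
    k                            ∎)
    where open ≡-Reasoning

  complement-class : ∀ b (p : ∣ b ∣ ≡ suc k) → (b , inj₂ p) W.≈ ℵᵛ (class k (complement b p))
  complement-class b p = W.sym {ℵᵛ (ℵᵛ v)} {v} (ℵπ-involutive k v)
    where
    v : Vertex (M k)
    v = b , inj₂ p

  label : ∀ v → ∃[ A ] (v W.≈ class k A ⊎ v W.≈ ℵᵛ (class k A))
  label v@(b , inj₁ p) = (b , p) , inj₁ (W.refl {v})
  label (b , inj₂ p) = complement b p , inj₂ (complement-class b p)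

  -- Adjacent strings have different weights, so one end has weight `k` and supplies `A`; the other
  -- is reached through its complemented reversal `A′`.
  edge-labels : ∀ e → ∃[ A ] ∃[ A′ ] Joins (M/π k) e (class k A) (ℵᵛ (class k A′))
  edge-labels (u@(a , inj₁ p) , (b , inj₂ q) , _) =
    (a , p) , complement b q , inj₁ (W.refl {u} , complement-class b q)
  edge-labels ((a , inj₂ p) , v@(b , inj₁ q) , _) =
    (b , q) , complement a p , inj₂ (complement-class a p , W.refl {v})
  edge-labels ((a , inj₁ p) , (b , inj₁ q) , d) = contradiction (trans p (sym q)) (differOnce-∣∣ a b d)
  edge-labels ((a , inj₂ p) , (b , inj₂ q) , d) = contradiction (trans p (sym q)) (differOnce-∣∣ a b d)

  -- A loop needs a single label for both ends, whereas `edge-labels` may give two. The label is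
  -- taken from the class `v` that witnesses horizontality.
  horizontal-label : ∀ {e} → Horizontal k e → ∃[ A ] Joins (M/π k) e (class k A) (ℵᵛ (class k A))
  horizontal-label {e} (v , q) with label v
  ... | A , inj₁ p = A , U.trans {to (ends (M/π k)) e} {v , ℵᵛ v} {class k A , ℵᵛ (class k A)} q
        (inj₁ (p , to-cong (onV (ℵπ k)) {v} {class k A} p))
  ... | A , inj₂ p = A , U.trans {to (ends (M/π k)) e} {v , ℵᵛ v} {class k A , ℵᵛ (class k A)} q
        (inj₂ (p , W.sym {class k A} {ℵᵛ v} (ℵᵛ-swap {class k A} {v} (W.sym {v} {ℵᵛ (class k A)} p))))

  class-surjective : ∀ v → ∃[ A ] class k A P.≈ v
  class-surjective v with label v
  ... | A , inj₁ p = A , P.sym {v} {class k A} (coarsen {v} {class k A} p)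
  ... | A , inj₂ p = A , P.sym {v} {class k A} (coarsen-ℵ {v} {class k A} p)

  -- The isomorphism onto the dihedral quotient.

  edge : Edge (R k) → Edge (M k)
  edge (inj₁ e) = S.edge e
  edge (inj₂ e) = H.edge e

  isHorizontal : (e : HorizontalEdge k) → Horizontal k (H.edge e)
  isHorizontal e = class k A , joins
    where open H e

  edge-cong : ∀ {e f} → Setoid._≈_ (E (R k)) e f → edge e G.≈ edge f
  edge-cong (inj₁ {e} {f} p) = mergeᵉ {S.edge e} {S.edge f} p
  edge-cong (inj₂ {e} {f} (j , p)) = (j , Sign.+) , p

  edge-injective : ∀ {e f} → edge e G.≈ edge f → Setoid._≈_ (E (R k)) e f
  edge-injective {inj₁ e} {inj₁ f} p = inj₁ (splitᵉ {S.edge e} {S.edge f} p)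
  edge-injective {inj₂ e} {inj₂ f} p =
    inj₂ (horizontal-orbit-injective {H.edge e} {H.edge f} p (isHorizontal f))
  edge-injective {inj₁ e} {inj₂ f} p = contradiction
    (horizontal-orbit {S.edge e} {H.edge f} p (isHorizontal f)) (S.skew e)
  edge-injective {inj₂ e} {inj₁ f} p = contradiction
    (horizontal-orbit {S.edge f} {H.edge e}
      (G.sym {H.edge e} {S.edge f} p) (isHorizontal e)) (S.skew f)

  -- Quotients coarsen the equality but keep the carrier, so an edge of `M` is itself the
  -- representative stored in an edge of `R`, and the equation is strict.
  edge-surjective : ∀ e → ∃[ f ] edge f ≡ e
  edge-surjective e = [ horizontal , skew ]′ (toSum (horizontal? e))
    where
    horizontal : Horizontal k e → ∃[ f ] edge f ≡ e
    horizontal h = inj₂ (record { A = proj₁ l ; edge = e ; joins = proj₂ l }) , refl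
      where
      l : ∃[ A ] Joins (M/π k) e (class k A) (ℵᵛ (class k A))
      l = horizontal-label {e} h

    skew : Skew k e → ∃[ f ] edge f ≡ e
    skew ¬h = inj₁ (record
      { A = proj₁ l ; A′ = proj₁ (proj₂ l) ; edge = e ; joins = proj₂ (proj₂ l) ; skew = ¬h }) , refl
      where
      l : ∃[ A ] ∃[ A′ ] Joins (M/π k) e (class k A) (ℵᵛ (class k A′))
      l = edge-labels e

  -- In the dihedral quotient `class k A′` and its image under `ℵᵛ` become the same vertex.
  joins-coarsen : ∀ {e A A′} → Joins (M/π k) e (class k A) (ℵᵛ (class k A′)) →
                  Joins (M k / dihedralAction) e (class k A) (class k A′)
  joins-coarsen {u , v , _} {A} {A′} (inj₁ (p , q)) =
    inj₁ (coarsen {u} {class k A} p , coarsen-ℵ {v} {class k A′} q)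
  joins-coarsen {u , v , _} {A} {A′} (inj₂ (p , q)) =
    inj₂ (coarsen-ℵ {u} {class k A′} p , coarsen {v} {class k A} q)

  R≅M/dihedral : R k ≅ M k / dihedralAction
  R≅M/dihedral = record
    { V-iso = Bijection⇒Inverse {S = V (R k)} {T = V (M k / dihedralAction)} record
      { to = class k
      ; cong = λ {A} {B} → mergeᵛ {class k A} {class k B}
      ; bijective = (λ {A} {B} → splitᵛ {class k A} {class k B})
                  , strictlySurjective⇒surjective (V (R k)) (V (M k / dihedralAction))
                      (λ {A} {B} → mergeᵛ {class k A} {class k B})
                      class-surjective
      }
    ; E-iso = Bijection⇒Inverse {S = E (R k)} {T = E (M k / dihedralAction)} record
      { to = edge
      ; cong = λ {e} {f} → edge-cong {e} {f}
      ; bijective = (λ {e} {f} → edge-injective {e} {f})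
                  , strictlySurjective⇒surjective (E (R k)) (E (M k / dihedralAction)) {f = edge}
                      (λ {e} {f} → edge-cong {e} {f})
                      (λ e → map₂ (λ {f} → G.reflexive {edge f} {e}) (edge-surjective e))
      }
    ; ends-iso = λ { (inj₁ e) → joins-coarsen {S.edge e} {S.A e} {S.A′ e} (S.joins e)
                 ; (inj₂ e) → joins-coarsen {H.edge e} {H.A e} {H.A e} (H.joins e) }
    }

theorem5 : (k : ℕ) → 0 < k →
    Σ[ Υ ∈ Action (Dihedral (suc (2 * k))) (M k) ] R k ≅ M k / Υ
theorem5 k _ = dihedralAction k , R≅M/dihedral k
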